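{- Let $\tau$ be a relational vocabulary whose relation symbols are at most binary. For every formula $\phi\in \mathsf{D}^2(\tau)$ there is a formula $\phi^*\in \mathsf{IF}^2(\tau)$ such that for all $\tau$-structures $\mathfrak{A}$ and all teams $X$ of $\mathfrak{A}$ with $\mathrm{dom}(X)=\{x,y\}$, $$\mathfrak{A}\models_X\phi \iff \mathfrak{A}\models_X\phi^*.$$
   Context: Syntax. Fix two variables $x,y$. Formulas of $\mathsf{D}^2(\tau)$ (two-variable dependence logic) are generated by $\phi::= t_1=t_2\mid R(t_1,\dots,t_n)\mid \neg t_1=t_2\mid \neg R(t_1,\dots,t_n)\mid =\!(t_1,t_2)\mid \neg =\!(t_1,t_2)\mid =\!(t_1)\mid\neg =\!(t_1)\mid(\phi\wedge\phi)\mid(\phi\vee\phi)\mid\forall x\phi\mid\forall y\phi\mid\exists x\phi\mid\exists y\phi$. Formulas of $\mathsf{IF}^2(\tau)$ (two-variable independence-friendly logic) are generated by $\phi::= t_1=t_2\mid R(t_1,\dots,t_n)\mid \neg t_1=t_2\mid \neg R(t_1,\dots,t_n)\mid(\phi\wedge\phi)\mid(\phi\vee\phi)\mid\forall x\phi\mid\forall y\phi\mid\exists x/W\phi\mid\exists y/W\phi$. Here $R\in\tau$ is $n$-ary, $t_1,\dots,t_n\in\{x,y\}$ and $W\subseteq\{x,y\}$; $\exists x/\emptyset\,\phi$ is identified with $\exists x\phi$. Teams. A team $X$ of $\mathfrak{A}$ (domain $A$) with domain $\mathrm{dom}(X)=\{x_1,\dots,x_k\}$ is any set of assignments $\{x_1,\dots,x_k\}\to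 A$. The assignment $s(a/x)$ has domain $\mathrm{dom}(s)\cup\{x\}$, maps $x$ to $a$ and agrees with $s$ elsewhere. For $F\colon X\to A$, $X(F/x)=\{s(F(s)/x)\mid s\in X\}$, and $X(A/x)=\{s(a/x)\mid s\in X,a\in A\}$. For $W\subseteq\mathrm{dom}(X)$, $F\colon X\to A$ is $W$-independent if $F(s)=F(s')$ whenever $s,s'\in X$ agree on $\mathrm{dom}(X)\setminus W$. Semantics. (1) For a first-order literal $\phi$: $\mathfrak{A}\models_X\phi$ iff every $s\in X$ satisfies $\phi$ in $\mathfrak{A}$ in the usual sense. (2) $\mathfrak{A}\models_X\psi\wedge\phi$ iff $\mathfrak{A}\models_X\psi$ and $\mathfrak{A}\models_X\phi$. (3) $\mathfrak{A}\models_X\psi\vee\phi$ iff $X=Y\cup Z$ for some teams $Y,Z$ with $\mathfrak{A}\models_Y\psi$ and $\mathfrak{A}\models_Z\phi$. (4) $\mathfrak{A}\models_X\exists v\psi$ iff $\mathfrak{A}\models_{X(F/v)}\psi$ for some $F\colon X\to A$. (5) $\mathfrak{A}\models_X\forall v\psi$ iff $\mathfrak{A}\models_{X(A/v)}\psi$. (6) $\mathfrak{A}\models_X\exists v/W\psi$ iff $\mathfrak{A}\models_{X(F/v)}\psi$ for some $W$-independent $F\colon X\to A$. (7) $\mathfrak{A}\models_X{=}(t_1,\dots,t_n)$ iff any $s,s'\in X$ that give equal values to each of $t_1,\dots,t_{n-1}$ give equal values to $t_n$. (8) $\mathfrak{A}\models_X\neg{=}(t_1,\dots,t_n)$ iff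 $X=\emptyset$. -}

module Defs where

open import Data.Fin using (Fin)
open import Data.Fin.Subset using (Subset; _∉_)
open import Data.List using (List; []; _∷_)
open import Data.List.Relation.Unary.All using (All)
open import Data.Nat using (ℕ)
open import Data.Product using (Σ-syntax; ∃; ∃-syntax; _×_; _,_; proj₁)
open import Data.Vec using (Vec; lookup; map; _[_]≔_)
open import Function.Bundles using (Func; _⟨$⟩_)
open import Level using (Level; Lift; suc; _⊔_)
open import Relation.Binary.Bundles using (Setoid)
open import Relation.Binary.PropositionalEquality using (_≡_; setoid)
import Relation.Binary.Construct.On as On
open import Relation.Nullary using (¬_)
open import Relation.Unary using (Pred; _∈_; _∪_; _≐_; Empty)

private
  variable
    r ℓ : Level

record Vocabulary r : Set (suc r) where
  field
    Symbol : Set r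
    arity  : Symbol → ℕ

open Vocabulary public

-- The two variables: 0 is x and 1 is y.  The vocabulary is relational, so
-- they are also the only terms.
Var : Set
Var = Fin 2

data Literal (τ : Vocabulary r) : Set r where
  eq neq   : Var → Var → Literal τ
  rel nrel : (R : Symbol τ) → Vec Var (arity τ R) → Literal τ

infixr 7 _∧_
infixr 6 _∨_

data D² (τ : Vocabulary r) : Set r where
  lit            : Literal τ → D² τ
  dep₂ ndep₂     : Var → Var → D² τ      -- =(t₁,t₂) and ¬=(t₁,t₂)
  dep₁ ndep₁     : Var → D² τ            -- =(t₁) and ¬=(t₁)
  _∧_ _∨_        : D² τ → D² τ → D² τ
  forAll exists  : Var → D² τ → D² τ

-- exists/ v W φ is ∃v/W φ; the plain quantifier ∃v is the case W = ∅.
data IF² (τ : Vocabulary r) : Set r where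
  lit      : Literal τ → IF² τ
  _∧_ _∨_  : IF² τ → IF² τ → IF² τ
  forAll   : Var → IF² τ → IF² τ
  exists/  : Var → Subset 2 → IF² τ → IF² τ

record Structure (τ : Vocabulary r) ℓ : Set (r ⊔ suc ℓ) where
  field
    Carrier : Set ℓ
    interp  : (R : Symbol τ) → Pred (Vec Carrier (arity τ R)) ℓ

open Structure public

-- Assignments with domain {x,y}.  Vectors rather than functions Var → A, so
-- that assignments with equal values are propositionally equal.
Assignment : Set ℓ → Set ℓ
Assignment A = Vec A 2

-- Teams with domain {x,y}; quantification never changes this domain.
-- Equality of teams is _≐_.
Team : Set ℓ → Set (suc ℓ)
Team {ℓ} A = Pred (Assignment A) ℓ

module _ {A : Set ℓ} where

  -- The members of X, identified when they are equal as assignments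
  -- (membership proofs are ignored).
  members : Team A → Setoid ℓ ℓ
  members X = On.setoid {B = ∃ X} (setoid (Assignment A)) proj₁

  -- Functions X → A; being setoid maps, they do not depend on the proof of
  -- membership.
  Choice : Team A → Set ℓ
  Choice X = Func (members X) (setoid A)

  -- X(F/v)
  supplement : (X : Team A) → Choice X → Var → Team A
  supplement X F v t = Σ[ m ∈ ∃ X ] t ≡ proj₁ m [ v ]≔ (F ⟨$⟩ m)

  -- X(A/v)
  duplicate : Team A → Var → Team A
  duplicate X v t = ∃[ s ] ∃[ a ] (s ∈ X × t ≡ s [ v ]≔ a)

  AgreeOutside : Subset 2 → Assignment A → Assignment A → Set ℓ
  AgreeOutside W s s′ = ∀ u → u ∉ W → lookup s u ≡ lookup s′ u

  Independent : Subset 2 → (X : Team A) → Choice X → Set ℓ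
  Independent W X F = ∀ (m m′ : ∃ X) → AgreeOutside W (proj₁ m) (proj₁ m′) →
                      F ⟨$⟩ m ≡ F ⟨$⟩ m′

  -- =(ts, t) holds in X.
  Dependence : List Var → Var → Team A → Set ℓ
  Dependence ts t X = ∀ s s′ → s ∈ X → s′ ∈ X →
                      All (λ u → lookup s u ≡ lookup s′ u) ts →
                      lookup s t ≡ lookup s′ t

module _ {τ : Vocabulary r} (𝔄 : Structure τ ℓ) where

  SatisfiesLit : Literal τ → Assignment (Carrier 𝔄) → Set ℓ
  SatisfiesLit (eq t u)    s = lookup s t ≡ lookup s u
  SatisfiesLit (neq t u)   s = ¬ (lookup s t ≡ lookup s u)
  SatisfiesLit (rel R ts)  s = interp 𝔄 R (map (lookup s) ts)
  SatisfiesLit (nrel R ts) s = ¬ interp 𝔄 R (map (lookup s) ts)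

  HoldsLit : Team (Carrier 𝔄) → Literal τ → Set ℓ
  HoldsLit X l = ∀ s → s ∈ X → SatisfiesLit l s

infix 4 _⊨ᴰ[_]_ _⊨ᴵ[_]_

-- The clause for _∨_ quantifies over teams, so satisfaction lives one
-- universe above the structure; Lift only adjusts levels.
_⊨ᴰ[_]_ : {τ : Vocabulary r} (𝔄 : Structure τ ℓ) → Team (Carrier 𝔄) → D² τ → Set (suc ℓ)
_⊨ᴰ[_]_ {ℓ = ℓ} 𝔄 X (lit l)      = Lift (suc ℓ) (HoldsLit 𝔄 X l)
_⊨ᴰ[_]_ {ℓ = ℓ} 𝔄 X (dep₂ t u)   = Lift (suc ℓ) (Dependence (t ∷ []) u X)
_⊨ᴰ[_]_ {ℓ = ℓ} 𝔄 X (ndep₂ t u)  = Lift (suc ℓ) (Empty X)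
_⊨ᴰ[_]_ {ℓ = ℓ} 𝔄 X (dep₁ t)     = Lift (suc ℓ) (Dependence [] t X)
_⊨ᴰ[_]_ {ℓ = ℓ} 𝔄 X (ndep₁ t)    = Lift (suc ℓ) (Empty X)
𝔄 ⊨ᴰ[ X ] (φ ∧ ψ)      = (𝔄 ⊨ᴰ[ X ] φ) × (𝔄 ⊨ᴰ[ X ] ψ)
𝔄 ⊨ᴰ[ X ] (φ ∨ ψ)      = Σ[ Y ∈ Team (Carrier 𝔄) ] Σ[ Z ∈ Team (Carrier 𝔄) ]
                         (X ≐ Y ∪ Z) × (𝔄 ⊨ᴰ[ Y ] φ) × (𝔄 ⊨ᴰ[ Z ] ψ)
𝔄 ⊨ᴰ[ X ] (forAll v φ) = 𝔄 ⊨ᴰ[ duplicate X v ] φ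
𝔄 ⊨ᴰ[ X ] (exists v φ) = Σ[ F ∈ Choice X ] 𝔄 ⊨ᴰ[ supplement X F v ] φ

_⊨ᴵ[_]_ : {τ : Vocabulary r} (𝔄 : Structure τ ℓ) → Team (Carrier 𝔄) → IF² τ → Set (suc ℓ)
_⊨ᴵ[_]_ {ℓ = ℓ} 𝔄 X (lit l) = Lift (suc ℓ) (HoldsLit 𝔄 X l)
𝔄 ⊨ᴵ[ X ] (φ ∧ ψ)         = (𝔄 ⊨ᴵ[ X ] φ) × (𝔄 ⊨ᴵ[ X ] ψ)
𝔄 ⊨ᴵ[ X ] (φ ∨ ψ)         = Σ[ Y ∈ Team (Carrier 𝔄) ] Σ[ Z ∈ Team (Carrier 𝔄) ]
                            (X ≐ Y ∪ Z) × (𝔄 ⊨ᴵ[ Y ] φ) × (𝔄 ⊨ᴵ[ Z ] ψ)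
𝔄 ⊨ᴵ[ X ] (forAll v φ)    = 𝔄 ⊨ᴵ[ duplicate X v ] φ
𝔄 ⊨ᴵ[ X ] (exists/ v W φ) = Σ[ F ∈ Choice X ] Independent W X F × (𝔄 ⊨ᴵ[ supplement X F v ] φ)

{-# OPTIONS --safe #-}
module Submission where

-- A team satisfies ∃v/W (u = v), for u distinct from v, exactly when the value
-- of u is determined by the values of the variables outside W: the only choice
-- function that makes u = v true is s ↦ s(u), and W-independence of that
-- function is that determinacy (lemma determination).  Overwriting v loses
-- nothing, since the literal u = v mentions only u and the fresh value.
-- With two variables this yields every dependence atom:
--   =(u)    is  ∃v/{x,y} (u = v), where v is the variable other than u;
--   =(t,u)  is  ∃t/{u} (u = t) when t and u differ, and trivial otherwise.
-- A negated dependence atom holds only in the empty team, as does ¬ t = t.  An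
-- unrestricted ∃v is ∃v/∅, every choice function being ∅-independent.  The
-- remaining connectives are translated homomorphically, and the equivalence
-- follows by induction on the formula, for all teams simultaneously.

open import Level using (Level; Lift; lift; lower)
open import Data.Nat using (_≤_)
open import Data.Product using (Σ-syntax; _,_; proj₁)
open import Data.Product.Function.NonDependent.Propositional using (_×-⇔_)
open import Data.Fin using (zero; suc; _≟_; opposite)
open import Data.Fin.Subset using (Subset; ⊤; ⊥; ⁅_⁆)
open import Data.Fin.Subset.Properties using (∈⊤; ∉⊥; x∈⁅x⁆; x∈⁅y⁆⇒x≡y)
open import Data.List using ([]; _∷_)
open import Data.List.Relation.Unary.All using ([]; _∷_)
open import Data.Vec using (Vec; lookup)
open import Data.Vec.Properties
  using (lookup∘update; lookup∘update′; tabulate∘lookup; tabulate-cong)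
open import Function using (_∘_)
open import Function.Bundles using (_⇔_; mk⇔; Func; _⟨$⟩_; module Equivalence)
open import Function.Construct.Composition using (_⇔-∘_)
open import Relation.Binary.PropositionalEquality
  using (_≡_; _≢_; refl; sym; trans; cong)
open import Relation.Nullary using (yes; no; contradiction)
open import Relation.Unary using (_∈_; Empty)
open import Defs

open Equivalence using (to; from)

private
  variable
    r ℓ : Level
    τ   : Vocabulary r
    A   : Set ℓ

opposite-≢ : (u : Var) → u ≢ opposite u
opposite-≢ zero       ()
opposite-≢ (suc zero) ()

≢-≢⇒≡ : {t u w : Var} → t ≢ u → w ≢ u → w ≡ t
≢-≢⇒≡ {zero}     {_}        {zero}     _   _   = refl
≢-≢⇒≡ {suc zero} {_}        {suc zero} _   _   = refl
≢-≢⇒≡ {zero}     {zero}     {suc zero} t≢u _   = contradiction refl t≢u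
≢-≢⇒≡ {zero}     {suc zero} {suc zero} _   w≢u = contradiction refl w≢u
≢-≢⇒≡ {suc zero} {zero}     {zero}     _   w≢u = contradiction refl w≢u
≢-≢⇒≡ {suc zero} {suc zero} {zero}     t≢u _   = contradiction refl t≢u

lookup-injective : ∀ {n} {s s′ : Vec A n} →
                   (∀ i → lookup s i ≡ lookup s′ i) → s ≡ s′
lookup-injective {s = s} {s′} h =
  trans (sym (tabulate∘lookup s)) (trans (tabulate-cong h) (tabulate∘lookup s′))

⊥-independent : (X : Team A) (F : Choice X) → Independent ⊥ X F
⊥-independent X F m m′ agree = Func.cong F (lookup-injective λ u → agree u ∉⊥)

-- The value of u in X is determined by the values of the variables outside W.
Determined : Subset 2 → Var → Team {ℓ} A → Set ℓ
Determined W u X = ∀ s s′ → s ∈ X → s′ ∈ X → AgreeOutside W s s′ →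
                   lookup s u ≡ lookup s′ u

-- The choice function s ↦ s(u).
project : (X : Team A) → Var → Choice X
project X u = record
  { to   = λ m → lookup (proj₁ m) u
  ; cong = cong (λ s → lookup s u)
  }

determination : (𝔄 : Structure τ ℓ) (X : Team (Carrier 𝔄)) (W : Subset 2)
                {u v : Var} → u ≢ v →
                Determined W u X ⇔ (𝔄 ⊨ᴵ[ X ] exists/ v W (lit (eq u v)))
determination 𝔄 X W {u} {v} u≢v = mk⇔ introduce eliminate
  where
  introduce : Determined W u X → 𝔄 ⊨ᴵ[ X ] exists/ v W (lit (eq u v))
  introduce d =
      project X u
    , (λ (s , s∈X) (s′ , s′∈X) → d s s′ s∈X s′∈X)
    , lift λ { _ ((s , _) , refl) →
        trans (lookup∘update′ u≢v s _) (sym (lookup∘update v s _)) }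

  eliminate : 𝔄 ⊨ᴵ[ X ] exists/ v W (lit (eq u v)) → Determined W u X
  eliminate (F , independent , lift holds) s s′ s∈X s′∈X agree =
    trans (value (s , s∈X))
      (trans (independent (s , s∈X) (s′ , s′∈X) agree)
             (sym (value (s′ , s′∈X))))
    where
    value : ∀ m → lookup (proj₁ m) u ≡ F ⟨$⟩ m
    value m@(s , _) =
      trans (sym (lookup∘update′ u≢v s _))
        (trans (holds _ (m , refl)) (lookup∘update v s _))

-- No variable lies outside ⊤, so all assignments agree there.
constancy⇔determined : (u : Var) (X : Team A) →
                       Dependence [] u X ⇔ Determined ⊤ u X
constancy⇔determined u X = mk⇔
  (λ d s s′ s∈X s′∈X _ → d s s′ s∈X s′∈X [])
  (λ d s s′ s∈X s′∈X _ →
    d s s′ s∈X s′∈X λ _ w∉⊤ → contradiction ∈⊤ w∉⊤)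

-- Since there are only two variables, t is the only one outside ⁅ u ⁆.
dependence⇔determined : {t u : Var} → t ≢ u → (X : Team A) →
                        Dependence (t ∷ []) u X ⇔ Determined ⁅ u ⁆ u X
dependence⇔determined {t = t} {u} t≢u X = mk⇔
  (λ d s s′ s∈X s′∈X agree →
    d s s′ s∈X s′∈X (agree t (t≢u ∘ x∈⁅y⁆⇒x≡y u) ∷ []))
  (λ { d s s′ s∈X s′∈X (tₛ≡tₛ′ ∷ []) →
    d s s′ s∈X s′∈X λ w w∉⁅u⁆ →
      outside s s′ tₛ≡tₛ′ (≢-≢⇒≡ t≢u λ { refl → w∉⁅u⁆ (x∈⁅x⁆ u) }) })
  where
  outside : ∀ s s′ → lookup s t ≡ lookup s′ t →
            ∀ {w} → w ≡ t → lookup s w ≡ lookup s′ w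
  outside s s′ tₛ≡tₛ′ refl = tₛ≡tₛ′

empty⇔neq : (𝔄 : Structure τ ℓ) (X : Team (Carrier 𝔄)) (u : Var) →
            Empty X ⇔ HoldsLit 𝔄 X (neq u u)
empty⇔neq 𝔄 X u = mk⇔
  (λ empty s s∈X → contradiction s∈X (empty s))
  (λ holds s s∈X → holds s s∈X refl)

-- The translation of two-variable dependence logic into two-variable
-- independence-friendly logic.  The atom =(t,t) is sent to the valid literal
-- t = t, because determination applies only to distinct variables.
infix 8 _*

_* : D² τ → IF² τ
lit l *      = lit l
dep₂ t u * with t ≟ u
... | yes _  = lit (eq t t)
... | no _   = exists/ t ⁅ u ⁆ (lit (eq u t))
ndep₂ t _ *  = lit (neq t t)
dep₁ u *     = exists/ (opposite u) ⊤ (lit (eq u (opposite u)))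
ndep₁ t *    = lit (neq t t)
(φ ∧ ψ) *    = φ * ∧ ψ *
(φ ∨ ψ) *    = φ * ∨ ψ *
forAll v φ * = forAll v (φ *)
exists v φ * = exists/ v ⊥ (φ *)

lift-⇔ : ∀ {a b} {P : Set a} {Q : Set a} → P ⇔ Q → Lift b P ⇔ Lift b Q
lift-⇔ P⇔Q = mk⇔ (lift ∘ to P⇔Q ∘ lower) (lift ∘ from P⇔Q ∘ lower)

lower-⇔ : ∀ {a b c} {P : Set a} {Q : Set c} → P ⇔ Q → Lift b P ⇔ Q
lower-⇔ P⇔Q = mk⇔ (to P⇔Q ∘ lower) (lift ∘ from P⇔Q)

*-correct : (φ : D² τ) (𝔄 : Structure τ ℓ) (X : Team (Carrier 𝔄)) →
            (𝔄 ⊨ᴰ[ X ] φ) ⇔ (𝔄 ⊨ᴵ[ X ] φ *)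
*-correct (lit l) 𝔄 X = mk⇔ (λ h → h) (λ h → h)
*-correct (dep₂ t u) 𝔄 X with t ≟ u
... | yes refl = mk⇔
  (λ _ → lift λ _ _ → refl)
  (λ _ → lift λ { _ _ _ _ (tₛ≡tₛ′ ∷ []) → tₛ≡tₛ′ })
... | no t≢u = lower-⇔
  (determination 𝔄 X ⁅ u ⁆ (t≢u ∘ sym) ⇔-∘ dependence⇔determined t≢u X)
*-correct (ndep₂ t _) 𝔄 X = lift-⇔ (empty⇔neq 𝔄 X t)
*-correct (dep₁ u) 𝔄 X = lower-⇔
  (determination 𝔄 X ⊤ (opposite-≢ u) ⇔-∘ constancy⇔determined u X)
*-correct (ndep₁ t) 𝔄 X = lift-⇔ (empty⇔neq 𝔄 X t)
*-correct (φ ∧ ψ) 𝔄 X = *-correct φ 𝔄 X ×-⇔ *-correct ψ 𝔄 X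
*-correct (φ ∨ ψ) 𝔄 X = mk⇔
  (λ (Y , Z , split , p , q) →
    Y , Z , split , to (*-correct φ 𝔄 Y) p , to (*-correct ψ 𝔄 Z) q)
  (λ (Y , Z , split , p , q) →
    Y , Z , split , from (*-correct φ 𝔄 Y) p , from (*-correct ψ 𝔄 Z) q)
*-correct (forAll v φ) 𝔄 X = *-correct φ 𝔄 (duplicate X v)
*-correct (exists v φ) 𝔄 X = mk⇔
  (λ (F , p) →
    F , ⊥-independent X F , to (*-correct φ 𝔄 (supplement X F v)) p)
  (λ (F , _ , p) → F , from (*-correct φ 𝔄 (supplement X F v)) p)

lemma3p1 : ∀ {r ℓ : Level} (τ : Vocabulary r) → (∀ (R : Symbol τ) → arity τ R ≤ 2) →
    ∀ (φ : D² τ) → Σ[ φ* ∈ IF² τ ]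
    (∀ (𝔄 : Structure τ ℓ) (X : Team (Carrier 𝔄)) →
    (𝔄 ⊨ᴰ[ X ] φ) ⇔ (𝔄 ⊨ᴵ[ X ] φ*))
lemma3p1 τ _ φ = φ * , *-correct φ
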